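{- Let $\mathrm{a}_{n,k}^{\mathrm{asc}}(213,312)$ (respectively $\mathrm{a}_{n,k}^{\mathrm{des}}(213,312)$) denote the number of permutations of $\{1,\dots,n\}$ that avoid both $213$ and $312$ and have exactly $k$ ascents (respectively $k$ descents). Then for all integers $n\ge 1$ and $k\ge 0$, $$\mathrm{a}_{n,k}^{\mathrm{asc}}(213,312)=\mathrm{a}_{n,k}^{\mathrm{des}}(213,312)=\binom{n-1}{k}.$$
   Context: $\mathcal{S}_n$ is the set of permutations $\pi=\pi_1\cdots\pi_n$ of $\{1,\dots,n\}$. For $\rho\in\mathcal{S}_m$, $\pi\in\mathcal{S}_n$ contains $\rho$ if there are indices $1\le i_1<\cdots<i_m\le n$ such that $\pi_{i_a}<\pi_{i_b}$ if and only if $\rho_a<\rho_b$; otherwise $\pi$ avoids $\rho$. The number of ascents is $\mathrm{asc}(\pi)=|\{i:\pi_i<\pi_{i+1}\}|$ and the number of descents is $\mathrm{des}(\pi)=|\{i:\pi_i>\pi_{i+1}\}|$, where $1\le i\le n-1$. -}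

module Defs where

open import Data.Fin.Base using (Fin; suc; inject₁; _<_)
open import Data.Fin.Patterns using (0F; 1F; 2F)
open import Data.Fin.Properties using (_≟_; _<?_; all?; any?)
open import Data.List.Base using (List; []; _∷_; length; filter; allFin; cartesianProductWith)
open import Data.List.Membership.Propositional using (_∈_; find; lose)
open import Data.List.Membership.Propositional.Properties
  using (∈-cartesianProductWith⁺; ∈-allFin)
import Data.List.Relation.Unary.Any as Any
open import Data.Nat.Base using (ℕ; zero; suc)
import Data.Nat.Properties as ℕ
open import Data.Product.Base using (_×_; _,_; ∃-syntax)
open import Data.Vec.Base using (Vec; []; _∷_; lookup)
open import Function.Bundles using (_⇔_; mk⇔; Equivalence)
open import Function.Definitions using (Injective; Surjective; Bijective)
open import Relation.Binary.PropositionalEquality.Core using (_≡_; refl)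
open import Relation.Nullary using (¬_; Dec)
open import Relation.Nullary.Decidable using (map′; _×-dec_; _→-dec_; ¬?)

private
  variable
    m n l : ℕ

-- A word is a sequence w₁⋯w_l; the letters 1,…,n are the elements of Fin n,
-- so every letter and every position is shifted down by one.
Word : ℕ → ℕ → Set
Word n l = Vec (Fin n) l

words : ∀ n l → List (Word n l)
words n zero    = [] ∷ []
words n (suc l) = cartesianProductWith _∷_ (allFin n) (words n l)

∈-words : (w : Word n l) → w ∈ words n l
∈-words []      = Any.here refl
∈-words (x ∷ w) = ∈-cartesianProductWith⁺ _∷_ (∈-allFin x) (∈-words w)

IsPermutation : Word n n → Set
IsPermutation π = Bijective _≡_ _≡_ (lookup π)

isPermutation? : (π : Word n n) → Dec (IsPermutation π)
isPermutation? {n} π = injective? ×-dec surjective?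
  where
  injective? : Dec (Injective _≡_ _≡_ (lookup π))
  injective? = map′ (λ f {i} {j} → f i j) (λ f i j → f {i} {j})
    (all? λ i → all? λ j → (lookup π i ≟ lookup π j) →-dec (i ≟ j))

  surjective? : Dec (Surjective _≡_ _≡_ (lookup π))
  surjective? = all? λ y → map′
    (λ { (i , eq) → i , λ { refl → eq } })
    (λ { (i , eq) → i , eq refl })
    (any? λ i → lookup π i ≟ y)

-- The permutations of {1,…,n} in one-line notation, each listed once.
𝒮 : ∀ n → List (Word n n)
𝒮 n = filter isPermutation? (words n n)

StrictlyIncreasing : Word n m → Set
StrictlyIncreasing i = ∀ a b → a < b → lookup i a < lookup i b

IsOccurrence : Word n n → Word m m → Word n m → Set
IsOccurrence π ρ i = StrictlyIncreasing i ×
  (∀ a b → lookup π (lookup i a) < lookup π (lookup i b) ⇔ lookup ρ a < lookup ρ b)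

_Contains_ : Word n n → Word m m → Set
π Contains ρ = ∃[ i ] IsOccurrence π ρ i

_Avoids_ : Word n n → Word m m → Set
π Avoids ρ = ¬ (π Contains ρ)

isOccurrence? : (π : Word n n) (ρ : Word m m) (i : Word n m) → Dec (IsOccurrence π ρ i)
isOccurrence? π ρ i =
  (all? λ a → all? λ b → (a <? b) →-dec (lookup i a <? lookup i b)) ×-dec
  (all? λ a → all? λ b →
    (lookup π (lookup i a) <? lookup π (lookup i b)) ⇔? (lookup ρ a <? lookup ρ b))
  where
  _⇔?_ : {A B : Set} → Dec A → Dec B → Dec (A ⇔ B)
  a? ⇔? b? = map′ (λ { (f , g) → mk⇔ f g })
    (λ e → Equivalence.to e , Equivalence.from e)
    ((a? →-dec b?) ×-dec (b? →-dec a?))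

_contains?_ : (π : Word n n) (ρ : Word m m) → Dec (π Contains ρ)
_contains?_ {n} {m} π ρ = map′
  (λ p → let (i , _ , occ) = find p in i , occ)
  (λ { (i , occ) → lose (∈-words i) occ })
  (Any.any? (isOccurrence? π ρ) (words n m))

_avoids?_ : (π : Word n n) (ρ : Word m m) → Dec (π Avoids ρ)
π avoids? ρ = ¬? (π contains? ρ)

asc : Word n l → ℕ
asc {l = zero}  w = 0
asc {l = suc l} w = length (filter (λ i → lookup w (inject₁ i) <? lookup w (suc i)) (allFin l))

-- w_i > w_{i+1} is by definition w_{i+1} < w_i.
des : Word n l → ℕ
des {l = zero}  w = 0
des {l = suc l} w = length (filter (λ i → lookup w (suc i) <? lookup w (inject₁ i)) (allFin l))

-- The number of π ∈ 𝒮 n that avoid both ρ and σ and satisfy st π = k.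
a : (st : ∀ {n} → Word n n → ℕ) (n k : ℕ) {p q : ℕ} → Word p p → Word q q → ℕ
a st n k ρ σ = length
  (filter (λ π → (π avoids? ρ) ×-dec (π avoids? σ) ×-dec (st π ℕ.≟ k)) (𝒮 n))

[213] [312] : Word 3 3
[213] = 1F ∷ 0F ∷ 2F ∷ []
[312] = 2F ∷ 0F ∷ 1F ∷ []

{-# OPTIONS --safe #-}

-- Avoiding 213 and 312 means having no valley, so the smallest letter stands
-- at one of the two ends.  Removing it leaves a valley-free permutation, and
-- putting a new smallest letter in front creates one ascent and no descent,
-- while putting it at the back creates one descent and no ascent.  Both
-- counts therefore satisfy Pascal's recurrence.
module Submission where

open import Defs
open import Data.Nat.Base using (ℕ; _≤_; _∸_)
open import Data.Nat.Combinatorics using (_C_)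
open import Data.Product.Base using (_×_)
open import Relation.Binary.PropositionalEquality.Core using (_≡_)

open import Data.Bool.Base using (true; false; if_then_else_)
open import Data.Fin.Base using (Fin; suc; toℕ; inject₁; fromℕ; punchIn; punchOut; _<_)
open import Data.Fin.Patterns using (0F; 1F; 2F)
import Data.Fin.Properties as Fin
open import Data.List.Base using (List; []; _∷_; _++_; allFin; filter; length; map)
open import Data.List.Membership.Propositional using (_∈_)
open import Data.List.Membership.Propositional.Properties
  using (∈-++⁺ˡ; ∈-++⁺ʳ; ∈-++⁻; ∈-filter⁺; ∈-filter⁻; ∈-map⁺; ∈-map⁻)
open import Data.List.Membership.Propositional.Properties.WithK using (unique∧set⇒bag)
open import Data.List.Properties using (filter-++; filter-≐; length-++; map-tabulate)
open import Data.List.Relation.Binary.BagAndSetEquality using (∼bag⇒↭)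
open import Data.List.Relation.Binary.Permutation.Propositional.Properties using (↭-length)
open import Data.List.Relation.Unary.All using ([])
open import Data.List.Relation.Unary.Any using (here)
open import Data.List.Relation.Unary.Unique.Propositional using (Unique; []; _∷_)
import Data.List.Relation.Unary.Unique.Propositional.Properties as Unique
open import Data.Nat.Base using (zero; suc; _+_; s≤s; z<s; s<s⁻¹)
open import Data.Nat.Combinatorics using (nCk+nC[k+1]≡[n+1]C[k+1]; k>n⇒nCk≡0)
import Data.Nat.Properties as ℕ
open import Data.Product.Base using (_,_; proj₁; proj₂; ∃-syntax)
open import Data.Sum.Base using (_⊎_; inj₁; inj₂; [_,_]′)
open import Data.Vec.Base as Vec using (Vec; []; _∷_; insertAt; lookup; tabulate)
open import Data.Vec.Properties
  using (insertAt-lookup; insertAt-punchIn; lookup-map; lookup∘tabulate;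
         tabulate∘lookup; tabulate-cong; ∷-injective)
open import Function.Base using (_∘_)
open import Function.Bundles using (_⇔_; mk⇔; module Equivalence)
open import Function.Definitions using (Injective; Surjective)
open import Level using (0ℓ)
open import Relation.Binary.Definitions using (tri<; tri≈; tri>)
open import Relation.Binary.PropositionalEquality
  using (_≢_; refl; sym; trans; cong; cong₂; subst; subst₂)
open import Relation.Nullary using (¬_; does; yes; no; contradiction)
open import Relation.Nullary.Decidable using (_×-dec_; from-yes)
open import Relation.Unary using (Pred; Decidable)

private
  variable
    m n l : ℕ
    A B : Set

-- Valleys and the patterns 213 and 312

ValleyFree : Word n l → Set
ValleyFree w = ∀ i j k → i < j → j < k →
  ¬ (lookup w j < lookup w i × lookup w j < lookup w k)

-- An occurrence of a pattern whose middle letter is below both outer ones is itself a valley.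
-- Keeping `ρ` general serves both patterns at once.
valleyFree⇒avoids : (ρ : Word 3 3) → lookup ρ 1F < lookup ρ 0F → lookup ρ 1F < lookup ρ 2F →
  (π : Word n n) → ValleyFree π → π Avoids ρ
valleyFree⇒avoids ρ ρ₁<ρ₀ ρ₁<ρ₂ π vf (i , inc , occ) =
  vf _ _ _ (inc 0F 1F z<s) (inc 1F 2F (s≤s z<s))
           (Equivalence.from (occ 1F 0F) ρ₁<ρ₀ , Equivalence.from (occ 1F 2F) ρ₁<ρ₂)

-- By trichotomy: `g a ≡ g b` would force `a ≡ b`, hence `f a ≡ f b`, and `g b < g a` would give
-- `f b < f a`. To exhibit an occurrence it then suffices to check the pairs that increase in the
-- pattern.
<-preserving⇒⇔ : {f : Fin l → Fin m} {g : Fin l → Fin n} → Injective _≡_ _≡_ g →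
  (∀ a b → g a < g b → f a < f b) → ∀ a b → f a < f b ⇔ g a < g b
<-preserving⇒⇔ {f = f} {g} g-inj mono a b = mk⇔ reflects (mono a b)
  where
  reflects : f a < f b → g a < g b
  reflects fa<fb with Fin.<-cmp (g a) (g b)
  ... | tri< lt _ _ = lt
  ... | tri≈ _ eq _ = contradiction fa<fb (ℕ.<-irrefl (cong (toℕ ∘ f) (g-inj eq)))
  ... | tri> _ _ gt = contradiction fa<fb (ℕ.<-asym (mono b a gt))

increasing₃ : {i j k : Fin n} → i < j → j < k → StrictlyIncreasing (i ∷ j ∷ k ∷ [])
increasing₃ i<j j<k 0F 1F _ = i<j
increasing₃ i<j j<k 0F 2F _ = ℕ.<-trans i<j j<k
increasing₃ i<j j<k 1F 2F _ = j<k
increasing₃ i<j j<k 1F 1F (s≤s ())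
increasing₃ i<j j<k 2F 1F (s≤s ())
increasing₃ i<j j<k 2F 2F (s≤s (s≤s ()))

-- The outer letters of a valley are distinct by injectivity. Their order decides whether the valley
-- is an occurrence of 213 or of 312.
avoids⇒valleyFree : (π : Word n n) → Injective _≡_ _≡_ (lookup π) →
  π Avoids [213] → π Avoids [312] → ValleyFree π
avoids⇒valleyFree π inj ¬213 ¬312 i j k i<j j<k (j<i , j<k′)
  with Fin.<-cmp (lookup π i) (lookup π k)
... | tri≈ _ eq _ = ℕ.<⇒≢ (ℕ.<-trans i<j j<k) (cong toℕ (inj eq))
... | tri< lt _ _ = ¬213 (i ∷ j ∷ k ∷ [] , increasing₃ i<j j<k ,
                          -- Injectivity of the concrete pattern comes from evaluating the decision
                          -- procedure.
                          <-preserving⇒⇔ (proj₁ (from-yes (isPermutation? [213]))) mono)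
  where
  mono : ∀ a b → lookup [213] a < lookup [213] b →
    lookup π (lookup (i ∷ j ∷ k ∷ []) a) < lookup π (lookup (i ∷ j ∷ k ∷ []) b)
  mono 0F 0F (s≤s ())
  mono 0F 2F _ = lt
  mono 1F 0F _ = j<i
  mono 1F 2F _ = j<k′
  mono 2F 0F (s≤s ())
  mono 2F 2F (s≤s (s≤s ()))
... | tri> _ _ gt = ¬312 (i ∷ j ∷ k ∷ [] , increasing₃ i<j j<k ,
                          <-preserving⇒⇔ (proj₁ (from-yes (isPermutation? [312]))) mono)
  where
  mono : ∀ a b → lookup [312] a < lookup [312] b →
    lookup π (lookup (i ∷ j ∷ k ∷ []) a) < lookup π (lookup (i ∷ j ∷ k ∷ []) b)
  mono 0F 0F (s≤s (s≤s ()))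
  mono 0F 2F (s≤s ())
  mono 1F 0F _ = j<i
  mono 1F 2F _ = j<k′
  mono 2F 0F _ = gt
  mono 2F 2F (s≤s ())

-- Inserting a new smallest letter

insertMin : Fin (suc l) → Word n l → Word (suc n) (suc l)
insertMin p w = insertAt (Vec.map suc w) p 0F

lookup-insertMin : (p : Fin (suc l)) (w : Word n l) → lookup (insertMin p w) p ≡ 0F
lookup-insertMin p w = insertAt-lookup (Vec.map suc w) p 0F

lookup-insertMin-punchIn : (p : Fin (suc l)) (w : Word n l) (i : Fin l) →
  lookup (insertMin p w) (punchIn p i) ≡ suc (lookup w i)
lookup-insertMin-punchIn p w i =
  trans (insertAt-punchIn (Vec.map suc w) p 0F i) (lookup-map i suc w)

-- A view of the positions of `insertMin p w`: the inserted letter, or position `i` of `w` shifted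
-- past it. Matching on it shows which of the two lookup lemmas applies.
data Punched (p : Fin (suc n)) : Fin (suc n) → Set where
  hole : Punched p p
  rest : ∀ i → Punched p (punchIn p i)

punched : (p j : Fin (suc n)) → Punched p j
punched p j with p Fin.≟ j
... | yes refl = hole
... | no p≢j   = subst (Punched p) (Fin.punchIn-punchOut p≢j) (rest (punchOut p≢j))

punchIn-mono-< : (p : Fin (suc n)) {i j : Fin n} → i < j → punchIn p i < punchIn p j
punchIn-mono-< p {i} {j} i<j = ℕ.≰⇒> (ℕ.<⇒≱ i<j ∘ Fin.punchIn-cancel-≤ p j i)

punchIn-cancel-< : (p : Fin (suc n)) {i j : Fin n} → punchIn p i < punchIn p j → i < j
punchIn-cancel-< p {i} {j} lt = ℕ.≰⇒> (ℕ.<⇒≱ lt ∘ Fin.punchIn-mono-≤ p j i)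

lookup-injective : {v w : Vec A l} → (∀ i → lookup v i ≡ lookup w i) → v ≡ w
lookup-injective {v = v} {w} eq =
  trans (sym (tabulate∘lookup v)) (trans (tabulate-cong eq) (tabulate∘lookup w))

insertMin-injective : (p : Fin (suc l)) {v w : Word n l} →
  insertMin p v ≡ insertMin p w → v ≡ w
insertMin-injective p {v} {w} eq = lookup-injective λ i → Fin.suc-injective
  (trans (sym (lookup-insertMin-punchIn p v i))
    (trans (cong (λ u → lookup u (punchIn p i)) eq) (lookup-insertMin-punchIn p w i)))

isPermutation-insertMin⁺ : (p : Fin (suc n)) {π : Word n n} →
  IsPermutation π → IsPermutation (insertMin p π)
isPermutation-insertMin⁺ {n} p {π} (inj , surj) = inj′ , surj′
  where
  inj′ : Injective _≡_ _≡_ (lookup (insertMin p π))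
  inj′ {i} {j} eq with punched p i | punched p j
  ... | hole   | hole   = refl
  ... | hole   | rest j = contradiction
    (trans (sym (lookup-insertMin p π)) (trans eq (lookup-insertMin-punchIn p π j))) λ ()
  ... | rest i | hole   = contradiction
    (trans (sym (lookup-insertMin p π)) (trans (sym eq) (lookup-insertMin-punchIn p π i))) λ ()
  ... | rest i | rest j = cong (punchIn p) (inj (Fin.suc-injective
    (trans (sym (lookup-insertMin-punchIn p π i)) (trans eq (lookup-insertMin-punchIn p π j)))))

  surj′ : Surjective _≡_ _≡_ (lookup (insertMin p π))
  surj′ 0F      = p , λ { refl → lookup-insertMin p π }
  surj′ (suc y) = let (i , eq) = surj y in
    punchIn p i , λ { refl → trans (lookup-insertMin-punchIn p π i) (cong suc (eq refl)) }

isPermutation-insertMin⁻ : (p : Fin (suc n)) {π : Word n n} →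
  IsPermutation (insertMin p π) → IsPermutation π
isPermutation-insertMin⁻ {n} p {π} (inj , surj) = inj′ , surj′
  where
  inj′ : Injective _≡_ _≡_ (lookup π)
  inj′ {i} {j} eq = Fin.punchIn-injective p i j (inj
    (trans (lookup-insertMin-punchIn p π i)
      (trans (cong suc eq) (sym (lookup-insertMin-punchIn p π j)))))

  surj′ : Surjective _≡_ _≡_ (lookup π)
  surj′ y with surj (suc y)
  ... | j , eq with punched p j
  ...   | hole   = contradiction (trans (sym (lookup-insertMin p π)) (eq refl)) λ ()
  ...   | rest i = i , λ { refl → Fin.suc-injective
                       (trans (sym (lookup-insertMin-punchIn p π i)) (eq refl)) }

-- Surjectivity supplies the position `p` of the letter `0F`. By injectivity all other letters are
-- nonzero, so each can be lowered by one to form `σ`.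
isPermutation⇒insertMin : {π : Word (suc n) (suc n)} → IsPermutation π →
  ∃[ p ] ∃[ σ ] π ≡ insertMin p σ
isPermutation⇒insertMin {n} {π} (inj , surj) = p , σ , lookup-injective agrees
  where
  p = proj₁ (surj 0F)

  πp≡0 : lookup π p ≡ 0F
  πp≡0 = proj₂ (surj 0F) refl

  nonzero : ∀ i → 0F ≢ lookup π (punchIn p i)
  nonzero i eq = Fin.punchInᵢ≢i p i (inj (trans (sym eq) (sym πp≡0)))

  σ : Word n n
  -- Punching out `0F` is the predecessor on nonzero letters.
  σ = tabulate λ i → punchOut (nonzero i)

  agrees : ∀ j → lookup π j ≡ lookup (insertMin p σ) j
  agrees j with punched p j
  ... | hole   = trans πp≡0 (sym (lookup-insertMin p σ))
  ... | rest i = sym (trans (lookup-insertMin-punchIn p σ i)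
    (trans (cong suc (lookup∘tabulate _ i)) (Fin.punchIn-punchOut (nonzero i))))

-- Where the smallest letter of a valley-free word stands

Extreme : Fin n → Set
Extreme {n} p = ∀ (i k : Fin n) → i < p → ¬ (p < k)

extreme-zero : Extreme {suc n} 0F
extreme-zero _ _ ()

extreme-fromℕ : Extreme (fromℕ n)
extreme-fromℕ _ k _ lt = ℕ.<⇒≱ lt (Fin.≤fromℕ k)

extreme⇒end : (p : Fin (suc n)) → Extreme p → p ≡ 0F ⊎ p ≡ fromℕ n
extreme⇒end 0F      ext = inj₁ refl
extreme⇒end {n} p@(suc _) ext with p Fin.≟ fromℕ n
... | yes eq = inj₂ eq
... | no neq = contradiction (Fin.≤∧≢⇒< (Fin.≤fromℕ p) neq) (ext 0F (fromℕ n) z<s)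

-- The new letter is not the bottom of a valley, since `p` lacks a position on one side. It is not
-- an outer letter either, since nothing lies below `0F`. Any other valley would already be one of
-- `w`.
valleyFree-insertMin⁺ : {p : Fin (suc l)} {w : Word n l} → Extreme p →
  ValleyFree w → ValleyFree (insertMin p w)
valleyFree-insertMin⁺ {p = p} {w} ext vf i j k i<j j<k (j<i , j<k′)
  with punched p i | punched p j | punched p k
... | _      | hole   | _      = ext _ _ i<j j<k
... | hole   | rest _ | _      = contradiction
  (subst (lookup (insertMin p w) j <_) (lookup-insertMin p w) j<i) λ ()
... | rest _ | rest _ | hole   = contradiction
  (subst (lookup (insertMin p w) j <_) (lookup-insertMin p w) j<k′) λ ()
... | rest i | rest j | rest k = vf i j k (punchIn-cancel-< p i<j) (punchIn-cancel-< p j<k)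
  ( s<s⁻¹ (subst₂ _<_ (lookup-insertMin-punchIn p w j) (lookup-insertMin-punchIn p w i) j<i)
  , s<s⁻¹ (subst₂ _<_ (lookup-insertMin-punchIn p w j) (lookup-insertMin-punchIn p w k) j<k′))

-- The new letter is below all others, so positions on both sides of `p` would make it the bottom of
-- a valley. A valley of `w` survives the insertion.
valleyFree-insertMin⁻ : {p : Fin (suc l)} {w : Word n l} →
  ValleyFree (insertMin p w) → Extreme p × ValleyFree w
valleyFree-insertMin⁻ {p = p} {w} vf = ext , λ i j k i<j j<k (j<i , j<k′) →
  vf _ _ _ (punchIn-mono-< p i<j) (punchIn-mono-< p j<k)
  ( subst₂ _<_ (sym (lookup-insertMin-punchIn p w j))
               (sym (lookup-insertMin-punchIn p w i)) (s≤s j<i)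
  , subst₂ _<_ (sym (lookup-insertMin-punchIn p w j))
               (sym (lookup-insertMin-punchIn p w k)) (s≤s j<k′))
  where
  positive : ∀ {j} → p ≢ j → lookup (insertMin p w) p < lookup (insertMin p w) j
  positive {j} p≢j with punched p j
  ... | hole   = contradiction refl p≢j
  ... | rest i = subst₂ _<_ (sym (lookup-insertMin p w)) (sym (lookup-insertMin-punchIn p w i)) z<s

  ext : Extreme p
  ext i k i<p p<k = vf i p k i<p p<k (positive (Fin.<⇒≢ i<p ∘ sym) , positive (Fin.<⇒≢ p<k))

-- Listing the valley-free permutations

front back : Word (suc n) (suc n) → Word (suc (suc n)) (suc (suc n))
front = insertMin 0F
back  = insertMin (fromℕ _)

-- The index is one less than the length, which yields the `n - 1` of the binomial coefficient. The
-- recursion starts at length 1 because both insertions into the empty word give the same word.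
unimodal : ∀ n → List (Word (suc n) (suc n))
unimodal zero    = (0F ∷ []) ∷ []
unimodal (suc n) = map front (unimodal n) ++ map back (unimodal n)

-- The first letter is `0F` on the left and a successor on the right, as the words are nonempty.
front≢back : (π σ : Word (suc n) (suc n)) → front π ≢ back σ
front≢back (_ ∷ _) (_ ∷ _) eq with () ← proj₁ (∷-injective eq)

unimodal-unique : ∀ n → Unique (unimodal n)
unimodal-unique zero    = [] ∷ []
unimodal-unique (suc n) = Unique.++⁺
  (Unique.map⁺ (insertMin-injective 0F) (unimodal-unique n))
  (Unique.map⁺ (insertMin-injective (fromℕ _)) (unimodal-unique n))
  λ (v∈front , v∈back) →
    let (π , _ , eq) = ∈-map⁻ front v∈front
        (σ , _ , eq′) = ∈-map⁻ back v∈back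
    in front≢back π σ (trans (sym eq) eq′)

unimodal-sound : ∀ n {π} → π ∈ unimodal n → IsPermutation π × ValleyFree π
unimodal-sound zero (here refl) =
  from-yes (isPermutation? (0F ∷ [])) , λ { 0F 0F _ () }
unimodal-sound (suc n) π∈ =
  [ insert extreme-zero ∘ ∈-map⁻ front , insert extreme-fromℕ ∘ ∈-map⁻ back ]′
    (∈-++⁻ (map front (unimodal n)) π∈)
  where
  insert : ∀ {p π} → Extreme p → ∃[ σ ] σ ∈ unimodal n × π ≡ insertMin p σ →
    IsPermutation π × ValleyFree π
  insert {p} ext (σ , σ∈ , refl) = let (perm , vf) = unimodal-sound n σ∈ in
    isPermutation-insertMin⁺ p {σ} perm , valleyFree-insertMin⁺ {p = p} {σ} ext vf

-- Induction by removing the smallest letter: valley-freeness puts it at an end, and the remaining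
-- word is again a valley-free permutation.
unimodal-complete : ∀ n {π} → IsPermutation π → ValleyFree π → π ∈ unimodal n
unimodal-complete zero {0F ∷ []} _ _ = here refl
unimodal-complete (suc n) {π} perm vf with isPermutation⇒insertMin {π = π} perm
... | p , σ , refl with valleyFree-insertMin⁻ {p = p} {w = σ} vf
...   | ext , vf′ with extreme⇒end p ext
                     | unimodal-complete n {σ} (isPermutation-insertMin⁻ p {σ} perm) vf′
...     | inj₁ refl | σ∈ = ∈-++⁺ˡ (∈-map⁺ front σ∈)
...     | inj₂ refl | σ∈ = ∈-++⁺ʳ (map front (unimodal n)) (∈-map⁺ back σ∈)

words-unique : ∀ n l → Unique (words n l)
words-unique n zero    = [] ∷ []
words-unique n (suc l) =
  Unique.cartesianProductWith⁺ _∷_ ∷-injective (Unique.allFin⁺ n) (words-unique n l)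

-- Counting by ascents and descents

length-filter-∷ : {P : Pred A 0ℓ} (P? : Decidable P) (x : A) (xs : List A) →
  length (filter P? (x ∷ xs)) ≡ (if does (P? x) then 1 else 0) + length (filter P? xs)
length-filter-∷ P? x xs with does (P? x)
... | true  = refl
... | false = refl

length-filter-map : {P : Pred B 0ℓ} (P? : Decidable P) (f : A → B) (xs : List A) →
  length (filter P? (map f xs)) ≡ length (filter (P? ∘ f) xs)
length-filter-map P? f []       = refl
length-filter-map P? f (x ∷ xs) with does (P? (f x))
... | true  = cong suc (length-filter-map P? f xs)
... | false = length-filter-map P? f xs

-- Splits off the first position, which turns `asc` and `des`, defined by filtering positions, into
-- recursions along the word.
length-filter-allFin : {P : Pred (Fin (suc n)) 0ℓ} (P? : Decidable P) →
  length (filter P? (allFin (suc n))) ≡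
  (if does (P? 0F) then 1 else 0) + length (filter (P? ∘ suc) (allFin n))
length-filter-allFin {n} P? = trans (length-filter-∷ P? 0F _)
  (cong (_ +_) (trans (cong (length ∘ filter P?) (sym (map-tabulate {n = n} (λ i → i) suc)))
                      (length-filter-map P? suc (allFin n))))

asc-∷∷ : (x y : Fin n) (w : Word n l) →
  asc (x ∷ y ∷ w) ≡ (if does (x Fin.<? y) then 1 else 0) + asc (y ∷ w)
asc-∷∷ x y w = length-filter-allFin
  λ i → lookup (x ∷ y ∷ w) (inject₁ i) Fin.<? lookup (x ∷ y ∷ w) (suc i)

des-∷∷ : (x y : Fin n) (w : Word n l) →
  des (x ∷ y ∷ w) ≡ (if does (y Fin.<? x) then 1 else 0) + des (y ∷ w)
des-∷∷ x y w = length-filter-allFin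
  λ i → lookup (x ∷ y ∷ w) (suc i) Fin.<? lookup (x ∷ y ∷ w) (inject₁ i)

-- Each adjacent pair keeps its indicator: `does (suc x Fin.<? suc y)` computes to
-- `does (x Fin.<? y)`.
asc-map-suc : (w : Word n l) → asc (Vec.map suc w) ≡ asc w
asc-map-suc []          = refl
asc-map-suc (x ∷ [])    = refl
asc-map-suc (x ∷ y ∷ w) = trans (asc-∷∷ (suc x) (suc y) (Vec.map suc w))
  (trans (cong (_ +_) (asc-map-suc (y ∷ w))) (sym (asc-∷∷ x y w)))

des-map-suc : (w : Word n l) → des (Vec.map suc w) ≡ des w
des-map-suc []          = refl
des-map-suc (x ∷ [])    = refl
des-map-suc (x ∷ y ∷ w) = trans (des-∷∷ (suc x) (suc y) (Vec.map suc w))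
  (trans (cong (_ +_) (des-map-suc (y ∷ w))) (sym (des-∷∷ x y w)))

-- The one new adjacent pair is `0F`, `suc x`. Its indicator computes to 1 for ascents and, in the
-- next lemma, to 0 for descents.
asc-insertMin-zero : (w : Word n (suc l)) → asc (insertMin 0F w) ≡ suc (asc w)
asc-insertMin-zero w@(x ∷ v) =
  trans (asc-∷∷ 0F (suc x) (Vec.map suc v)) (cong suc (asc-map-suc w))

des-insertMin-zero : (w : Word n (suc l)) → des (insertMin 0F w) ≡ des w
des-insertMin-zero w@(x ∷ v) =
  trans (des-∷∷ 0F (suc x) (Vec.map suc v)) (des-map-suc w)

-- The recursion runs to the last letter `x`, where the new pair `suc x`, `0F` is a descent.
asc-insertMin-fromℕ : (w : Word n (suc l)) → asc (insertMin (fromℕ _) w) ≡ asc w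
asc-insertMin-fromℕ (x ∷ [])    = refl
asc-insertMin-fromℕ (x ∷ y ∷ w) = trans (asc-∷∷ (suc x) (suc y) _)
  (trans (cong (_ +_) (asc-insertMin-fromℕ (y ∷ w))) (sym (asc-∷∷ x y w)))

des-insertMin-fromℕ : (w : Word n (suc l)) → des (insertMin (fromℕ _) w) ≡ suc (des w)
des-insertMin-fromℕ (x ∷ [])    = refl
des-insertMin-fromℕ (x ∷ y ∷ w) = trans (des-∷∷ (suc x) (suc y) _)
  (trans (cong (_ +_) (des-insertMin-fromℕ (y ∷ w)))
    (trans (ℕ.+-suc _ _) (cong suc (sym (des-∷∷ x y w)))))

-- Pascal's recurrence for both statistics

count : (A → ℕ) → ℕ → List A → ℕ
count st k xs = length (filter (λ x → st x ℕ.≟ k) xs)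

count-++ : (st : A → ℕ) (k : ℕ) (xs ys : List A) →
  count st k (xs ++ ys) ≡ count st k xs + count st k ys
count-++ st k xs ys = trans (cong length (filter-++ _ xs ys)) (length-++ (filter _ xs))

module _ {st : A → ℕ} {st′ : B → ℕ} {f : A → B} where

  count-map-preserving : (∀ x → st′ (f x) ≡ st x) → ∀ k xs →
    count st′ k (map f xs) ≡ count st k xs
  count-map-preserving eq k xs = trans (length-filter-map _ f xs)
    (cong length (filter-≐ _ _ ((λ {x} → trans (sym (eq x))) , (λ {x} → trans (eq x))) xs))

  count-map-suc : (∀ x → st′ (f x) ≡ suc (st x)) → ∀ k xs →
    count st′ (suc k) (map f xs) ≡ count st k xs
  count-map-suc eq k xs = trans (length-filter-map _ f xs)
    (cong length (filter-≐ _ _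
      ((λ {x} → ℕ.suc-injective ∘ trans (sym (eq x))) , (λ {x} → trans (eq x) ∘ cong suc)) xs))

  count-map-zero : (∀ x → st′ (f x) ≡ suc (st x)) → ∀ xs → count st′ 0 (map f xs) ≡ 0
  count-map-zero eq []       = refl
  count-map-zero eq (x ∷ xs) rewrite eq x = count-map-zero eq xs

pascal : (c : ℕ → ℕ → ℕ) → c 0 0 ≡ 1 → (∀ k → c 0 (suc k) ≡ 0) →
  (∀ n → c (suc n) 0 ≡ c n 0) → (∀ n k → c (suc n) (suc k) ≡ c n k + c n (suc k)) →
  ∀ n k → c n k ≡ n C k
pascal c c₀₀ c₀ₛ cₛ₀ cₛₛ = go
  where
  go : ∀ n k → c n k ≡ n C k
  go zero    zero    = c₀₀
  go zero    (suc k) = trans (c₀ₛ k) (sym (k>n⇒nCk≡0 {0} {suc k} z<s))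
  -- `suc n C 0` and `n C 0` agree by computation.
  go (suc n) zero    = trans (cₛ₀ n) (go n 0)
  go (suc n) (suc k) = trans (cₛₛ n k)
    (trans (cong₂ _+_ (go n k) (go n (suc k))) (nCk+nC[k+1]≡[n+1]C[k+1] n k))

count-asc : ∀ n k → count asc k (unimodal n) ≡ n C k
count-asc = pascal (λ n k → count asc k (unimodal n)) refl (λ _ → refl)
  (λ n → trans (count-++ asc 0 (map front (unimodal n)) _)
    -- Every word from `front` has an ascent, so only `back` contributes to the count of words
    -- without ascents.
    (cong₂ _+_ (count-map-zero asc-insertMin-zero (unimodal n))
               (count-map-preserving asc-insertMin-fromℕ 0 (unimodal n))))
  (λ n k → trans (count-++ asc (suc k) (map front (unimodal n)) _)
    (cong₂ _+_ (count-map-suc asc-insertMin-zero k (unimodal n))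
               (count-map-preserving asc-insertMin-fromℕ (suc k) (unimodal n))))

count-des : ∀ n k → count des k (unimodal n) ≡ n C k
count-des = pascal (λ n k → count des k (unimodal n)) refl (λ _ → refl)
  (λ n → trans (count-++ des 0 (map front (unimodal n)) _)
    (trans (cong₂ _+_ (count-map-preserving des-insertMin-zero 0 (unimodal n))
                      (count-map-zero des-insertMin-fromℕ (unimodal n)))
           (ℕ.+-identityʳ _)))
  (λ n k → trans (count-++ des (suc k) (map front (unimodal n)) _)
    (trans (cong₂ _+_ (count-map-preserving des-insertMin-zero (suc k) (unimodal n))
                      (count-map-suc des-insertMin-fromℕ k (unimodal n)))
           -- For descents it is `back`, the second summand, that raises the statistic, so the terms
           -- arrive in the opposite order to Pascal's rule.
           (ℕ.+-comm _ (count des k (unimodal n)))))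

-- From the recursive list to the numbers in the theorem

a≡count-unimodal : (st : ∀ {n} → Word n n → ℕ) (n k : ℕ) →
  a st (suc n) k [213] [312] ≡ count st k (unimodal n)
-- Two lists without repetitions and with the same members are rearrangements of each other, hence
-- equally long.
a≡count-unimodal st n k = ↭-length (∼bag⇒↭ (unique∧set⇒bag
  (Unique.filter⁺ P? (Unique.filter⁺ isPermutation? (words-unique (suc n) (suc n))))
  (Unique.filter⁺ Q? (unimodal-unique n))
  (mk⇔ to from)))
  where
  P? = λ (π : Word (suc n) (suc n)) →
    (π avoids? [213]) ×-dec (π avoids? [312]) ×-dec (st π ℕ.≟ k)
  Q? = λ (π : Word (suc n) (suc n)) → st π ℕ.≟ k

  to : ∀ {π} → π ∈ filter P? (𝒮 (suc n)) → π ∈ filter Q? (unimodal n)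
  to {π} π∈ =
    let (π∈𝒮 , ¬213 , ¬312 , eq) = ∈-filter⁻ P? {xs = 𝒮 (suc n)} π∈
        (_ , perm) = ∈-filter⁻ isPermutation? {xs = words (suc n) (suc n)} π∈𝒮
        vf = avoids⇒valleyFree π (proj₁ perm) ¬213 ¬312
    in ∈-filter⁺ Q? (unimodal-complete n perm vf) eq

  from : ∀ {π} → π ∈ filter Q? (unimodal n) → π ∈ filter P? (𝒮 (suc n))
  from {π} π∈ =
    let (π∈U , eq) = ∈-filter⁻ Q? {xs = unimodal n} π∈
        (perm , vf) = unimodal-sound n π∈U
    in ∈-filter⁺ P? (∈-filter⁺ isPermutation? (∈-words π) perm)
         ( valleyFree⇒avoids [213] z<s z<s π vf
         , valleyFree⇒avoids [312] z<s z<s π vf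
         , eq)

proposition6 : ∀ (n k : ℕ) → 1 ≤ n →
    (a asc n k [213] [312] ≡ a des n k [213] [312]) × (a des n k [213] [312] ≡ (n ∸ 1) C k)
proposition6 (suc n) k _ = trans asc≡C (sym des≡C) , des≡C
  where
  asc≡C : a asc (suc n) k [213] [312] ≡ n C k
  asc≡C = trans (a≡count-unimodal asc n k) (count-asc n k)

  des≡C : a des (suc n) k [213] [312] ≡ n C k
  des≡C = trans (a≡count-unimodal des n k) (count-des n k)
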